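{- For a relation $\alpha\subseteq A\times A$ the following are equivalent: (1) $\alpha$ is a half-space quasiorder on $A$; (2) there exist an equivalence relation $\varepsilon$ on $A$, a linear order $R$ on $A/\varepsilon$ (strict part $<_R$), and a function $t:A/\varepsilon\to\{0,1\}$ with $t([a]_\varepsilon)=0$ whenever $[a]_\varepsilon=\{a\}$, such that $$\alpha=\Delta_A\cup\{(a,b)\in A\times A\mid [a]_\varepsilon=[b]_\varepsilon,\ t([a]_\varepsilon)=1\}\cup\{(a,b)\in A\times A\mid [a]_\varepsilon<_R[b]_\varepsilon\};$$ (3) there exist a set $X$, a subset $X_1\subseteq X$, a linear order $R$ on $X$ and a function $f:A\to X$ with $\alpha=\ker_{X_1}(f)\cup f^{ -1}(R)$; (4) there exists an equivalence relation $\varepsilon$ on $A$ such that on each $\varepsilon$-class $C$ the restriction $\alpha\cap(C\times C)$ is either $C\times C$ or $\Delta_C$, and for every set $T$ containing exactly one element of each $\varepsilon$-class, $\alpha\cap(T\times T)$ is a linear order on $T$ (and $\alpha$ is determined by this, i.e. for $a,b$ in distinct classes, $(a,b)\in\alpha$ iff $(a',b')\in\alpha$ for all $a'\in[a]_\varepsilon$, $b'\in[b]_\varepsilon$).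
   Context: A quasiorder on $A$ is a reflexive and transitive relation; $\Delta_A=\{(a,a)\mid a\in A\}$. A quasiorder $\alpha$ on $A$ is a half-space if there is a quasiorder $\beta$ on $A$ with $\alpha\cup\beta=A\times A$ and $\alpha\cap\beta=\Delta_A$. For $f:A\to X$, $X_1\subseteq X$ and a linear order $R$ on $X$ (strict part $<_R$): $\ker_{X_1}(f)=\Delta_A\cup\{(a,b)\in A\times A\mid f(a)=f(b)\in X_1\}$ and $f^{ -1}(R)=\Delta_A\cup\{(a,b)\in A\times A\mid f(a)<_Rf(b)\}$. -}

module Defs where

open import Level using (Level; suc)
open import Data.Fin.Base using (Fin)
open import Data.Fin.Patterns using (0F; 1F)
open import Data.Product.Base using (Σ; ∃; _×_; proj₁)
open import Data.Product using (∃!)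
open import Data.Sum.Base using (_⊎_)
open import Function.Base using (_on_)
open import Function.Bundles using (Func; _⟨$⟩_) renaming (_⇔_ to _iff_)
open import Relation.Binary.Bundles using (Setoid)
open import Relation.Binary.Core using (REL; Rel; _⇔_)
open import Relation.Binary.Construct.Intersection using (_∩_)
open import Relation.Binary.Construct.Union using (_∪_)
open import Relation.Binary.Definitions using (_Respectsˡ_; _Respectsʳ_)
open import Relation.Binary.PropositionalEquality using (_≡_; setoid)
open import Relation.Binary.Structures using (IsEquivalence; IsPreorder; IsTotalOrder)
open import Relation.Nullary using (¬_)
open import Relation.Unary using (Pred; _∈_; ｛_｝; _≐_; U)
import Relation.Binary.Construct.NonStrictToStrict as ToStrict

private
  variable
    ℓ ℓ₁ : Level

-- The axiom of choice of classical set theory, where sets modulo an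
-- equivalence are setoids: the choice function must respect the equalities.
-- (Choosing without that requirement is trivial for Σ.)  By Diaconescu's
-- argument this entails excluded middle for all types in Set ℓ.
AxiomOfChoice : (ℓ : Level) → Set (suc ℓ)
AxiomOfChoice ℓ =
  (S T : Setoid ℓ ℓ) →
  let module S = Setoid S
      module T = Setoid T
  in
  (P : REL S.Carrier T.Carrier ℓ) →
  P Respectsˡ S._≈_ → P Respectsʳ T._≈_ →
  (∀ x → ∃ λ y → P x y) →
  Σ (Func S T) λ f → ∀ x → P x (f ⟨$⟩ x)

-- Relations are compared by _⇔_ and subsets by _≐_ (mutual inclusion); the
-- diagonal Δ is _≡_.

module _ {A : Set ℓ} where

  infix 8 _²

  _² : Pred A ℓ₁ → Rel A ℓ₁
  (C ²) a b = a ∈ C × b ∈ C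

  IsQuasiorder : Rel A ℓ → Set ℓ
  IsQuasiorder α = IsPreorder _≡_ α

  IsHalfSpace : Rel A ℓ → Set (suc ℓ)
  IsHalfSpace α = IsQuasiorder α ×
    Σ (Rel A ℓ) λ β → IsQuasiorder β × (α ∪ β ⇔ U ²) × (α ∩ β ⇔ _≡_)

  [_]_ : A → Rel A ℓ → Pred A ℓ
  ([ a ] ε) b = ε a b

  -- The quotient A/ε: [a] = [b] is ε a b.
  Quotient : (ε : Rel A ℓ) → IsEquivalence ε → Setoid ℓ ℓ
  Quotient ε isEq = record { Carrier = A ; _≈_ = ε ; isEquivalence = isEq }

IsLinearOrderOn : (S : Setoid ℓ ℓ) → Rel (Setoid.Carrier S) ℓ → Set ℓ
IsLinearOrderOn S R = IsTotalOrder (Setoid._≈_ S) R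

StrictPart : (S : Setoid ℓ ℓ) → Rel (Setoid.Carrier S) ℓ → Rel (Setoid.Carrier S) ℓ
StrictPart S R = ToStrict._<_ (Setoid._≈_ S) R

module _ {A : Set ℓ} where

  QuotientForm : Rel A ℓ → Set (suc ℓ)
  QuotientForm α =
    Σ (Rel A ℓ) λ ε →
    Σ (IsEquivalence ε) λ isEq →
    let A/ε = Quotient ε isEq in
    Σ (Rel A ℓ) λ R →
    IsLinearOrderOn A/ε R ×
    Σ (Func A/ε (setoid (Fin 2))) λ t →
    (∀ a → [ a ] ε ≐ ｛ a ｝ → t ⟨$⟩ a ≡ 0F) ×
    (α ⇔ (_≡_ ∪ (λ a b → ε a b × t ⟨$⟩ a ≡ 1F) ∪ StrictPart A/ε R))

  ker : {X : Set ℓ} → Pred X ℓ → (A → X) → Rel A ℓ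
  ker X₁ f = _≡_ ∪ (λ a b → f a ≡ f b × f a ∈ X₁)

  preimage : {X : Set ℓ} → (A → X) → Rel X ℓ → Rel A ℓ
  preimage {X} f R = _≡_ ∪ (StrictPart (setoid X) R on f)

  KernelForm : Rel A ℓ → Set (suc ℓ)
  KernelForm α =
    Σ (Set ℓ) λ X →
    Σ (Pred X ℓ) λ X₁ →
    Σ (Rel X ℓ) λ R →
    IsLinearOrderOn (setoid X) R ×
    Σ (A → X) λ f →
    α ⇔ (ker X₁ f ∪ preimage f R)

  IsTransversal : Rel A ℓ → Pred A ℓ → Set ℓ
  IsTransversal ε T = ∀ a → ∃! _≡_ λ x → x ∈ T × x ∈ [ a ] ε

  -- The subset T as a set in its own right; membership proofs are irrelevant
  -- to equality of elements.
  Subset : Pred A ℓ → Setoid ℓ ℓ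
  Subset T = record
    { Carrier       = Σ A T
    ; _≈_           = _≡_ on proj₁
    ; isEquivalence = On.isEquivalence proj₁ (Setoid.isEquivalence (setoid A))
    }
    where import Relation.Binary.Construct.On as On

  TransversalForm : Rel A ℓ → Set (suc ℓ)
  TransversalForm α =
    Σ (Rel A ℓ) λ ε →
    IsEquivalence ε ×
    (∀ c → let C = [ c ] ε in
      (α ∩ C ² ⇔ C ²) ⊎ (α ∩ C ² ⇔ _≡_ ∩ C ²)) ×
    (∀ (T : Pred A ℓ) → IsTransversal ε T →
      IsLinearOrderOn (Subset T) (α on proj₁)) ×
    (∀ a b → ¬ ε a b →
      α a b iff (∀ a′ b′ → a′ ∈ [ a ] ε → b′ ∈ [ b ] ε → α a′ b′))

{-# OPTIONS --safe #-}

-- Two elements are ε-equivalent when both pairs lie in α or both lie in the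
-- complementary quasiorder β; then α-related pairs in different classes are
-- ordered linearly, and every class is either full or discrete.  Conversely
-- a kernel form has as complement the kernel form for the complement of X₁
-- and the opposite order.  Choice supplies a representative of every class,
-- and the set of representatives serves both as the set X and as a
-- transversal.

module Submission where

open import Level using (Level; Lift; lift; lower)
open import Axiom.UniquenessOfIdentityProofs using (module Decidable⇒UIP)
open import Data.Bool.Base using (Bool; true; false)
open import Data.Bool.Properties using (_≟_)
open import Data.Empty using (⊥-elim)
open import Data.Fin.Base using (Fin)
open import Data.Fin.Patterns using (0F; 1F)
open import Data.Product.Base using (Σ; ∃; _×_; _,_; proj₁; proj₂)
open import Data.Sum.Base using (_⊎_; inj₁; inj₂)
open import Data.Unit.Base using (tt)
open import Function.Base using (_∘_; _on_; flip)
open import Function.Bundles using (_⇔_; mk⇔; Func; _⟨$⟩_; module Equivalence)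
open import Relation.Binary.Bundles using (Setoid)
open import Relation.Binary.Core using (Rel) renaming (_⇔_ to _⇔ᵣ_)
open import Relation.Binary.Construct.Intersection using (_∩_)
open import Relation.Binary.Construct.Union using (_∪_)
open import Relation.Binary.Definitions using (Transitive)
open import Relation.Binary.PropositionalEquality using (_≡_; _≢_; refl; sym; trans; cong; subst; setoid; isEquivalence)
open import Relation.Binary.Structures using (IsEquivalence; IsPreorder; IsTotalOrder)
open import Relation.Nullary using (¬_; Dec; yes; no)
open import Relation.Unary using (Pred; _∈_; ∁; ｛_｝; _≐_)
import Relation.Binary.Construct.Flip.EqAndOrd as Flip
import Relation.Binary.Construct.NonStrictToStrict as ToStrict
import Relation.Binary.Construct.On as On
open import Defs

private
  variable
    ℓ : Level

-- Excluded middle from choice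

-- Diaconescu: a choice function on the booleans with true and false
-- identified whenever P holds decides P.
choice⇒excluded-middle : AxiomOfChoice ℓ → (P : Set ℓ) → Dec P
choice⇒excluded-middle {ℓ} ac P = decide (value true ≟ value false)
  where
  _~_ : Rel (Lift ℓ Bool) ℓ
  x ~ y = x ≡ y ⊎ P

  ~-isEquivalence : IsEquivalence _~_
  ~-isEquivalence = record
    { refl  = inj₁ refl
    ; sym   = λ { (inj₁ p) → inj₁ (sym p) ; (inj₂ p) → inj₂ p }
    ; trans = ~-trans
    }
    where
    ~-trans : Transitive _~_
    ~-trans (inj₁ refl) q = q
    ~-trans (inj₂ p)    _ = inj₂ p

  open IsEquivalence ~-isEquivalence using () renaming (sym to ~-sym; trans to ~-trans)

  chosen : Σ (Func (Quotient _~_ ~-isEquivalence) (setoid (Lift ℓ Bool))) λ f → ∀ x → x ~ (f ⟨$⟩ x)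
  chosen = ac _ _ _~_ (λ p q → ~-trans (~-sym p) q) (λ { refl q → q }) (λ x → x , inj₁ refl)

  value : Bool → Bool
  value b = lower (proj₁ chosen ⟨$⟩ lift b)

  decide : Dec (value true ≡ value false) → Dec P
  decide (no ¬eq) = no λ p → ¬eq (cong lower (Func.cong (proj₁ chosen) (inj₂ p)))
  decide (yes eq)
    -- Each boolean is related to its chosen value, so equal values relate `true` to `false`. As
    -- these are distinct, only `P` can be the reason.
    with ~-trans (proj₂ chosen (lift true))
                 (~-trans (inj₁ (cong lift eq)) (~-sym (proj₂ chosen (lift false))))
  ... | inj₂ p = yes p

-- Indicators of decided propositions

indicator : {P : Set ℓ} → Dec P → Fin 2
indicator (yes _) = 1F
indicator (no _)  = 0F

module _ {P : Set ℓ} where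

  indicator≡1⇒holds : (d : Dec P) → indicator d ≡ 1F → P
  indicator≡1⇒holds (yes p) _ = p

  holds⇒indicator≡1 : (d : Dec P) → P → indicator d ≡ 1F
  holds⇒indicator≡1 (yes _) _ = refl
  holds⇒indicator≡1 (no ¬p) p = ⊥-elim (¬p p)

  fails⇒indicator≡0 : (d : Dec P) → ¬ P → indicator d ≡ 0F
  fails⇒indicator≡0 (yes p) ¬p = ⊥-elim (¬p p)
  fails⇒indicator≡0 (no _)  _  = refl

indicator-cong : {P Q : Set ℓ} (d : Dec P) (e : Dec Q) → (P → Q) → (Q → P) → indicator d ≡ indicator e
indicator-cong (yes p) e P→Q _ = sym (holds⇒indicator≡1 e (P→Q p))
indicator-cong (no ¬p) e _ Q→P = sym (fails⇒indicator≡0 e (¬p ∘ Q→P))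

-- Kernel forms are quasiorders

module _ {A X : Set ℓ} (X₁ : Pred X ℓ) {R : Rel X ℓ} (R-linear : IsLinearOrderOn (setoid X) R) (f : A → X) where

  private
    module R = IsTotalOrder R-linear
    module < = ToStrict _≡_ R

  -- A strict step absorbs equalities of values on either side, and two equalities inside `X₁`
  -- compose. Keeping `X₁` and `R` arbitrary lets the complementary relation be covered as well.
  kernelForm-isQuasiorder : IsQuasiorder (ker X₁ f ∪ preimage f R)
  kernelForm-isQuasiorder = record
    { isEquivalence = isEquivalence
    ; reflexive     = inj₁ ∘ inj₁
    ; trans         = transitive
    }
    where
    transitive : Transitive (ker X₁ f ∪ preimage f R)
    -- The diagonal belongs to both `ker` and `preimage`, so it occurs twice on each side.
    transitive (inj₁ (inj₁ refl)) q = q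
    transitive (inj₂ (inj₁ refl)) q = q
    transitive p (inj₁ (inj₁ refl)) = p
    transitive p (inj₂ (inj₁ refl)) = p
    transitive (inj₁ (inj₂ (p , x))) (inj₁ (inj₂ (q , _))) = inj₁ (inj₂ (trans p q , x))
    transitive {k = c} (inj₁ (inj₂ (p , _))) (inj₂ (inj₂ q)) =
      inj₂ (inj₂ (subst (λ x → x <.< f c) (sym p) q))
    transitive {i = a} (inj₂ (inj₂ p)) (inj₁ (inj₂ (q , _))) =
      inj₂ (inj₂ (subst (f a <.<_) q p))
    transitive (inj₂ (inj₂ p)) (inj₂ (inj₂ q)) =
      inj₂ (inj₂ (<.<-trans R.isPartialOrder p q))

⇔-isQuasiorder : {A : Set ℓ} {α γ : Rel A ℓ} → (∀ {a b} → α a b → γ a b) → (∀ {a b} → γ a b → α a b) →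
  IsQuasiorder γ → IsQuasiorder α
⇔-isQuasiorder to from γ-quasiorder = record
  { isEquivalence = isEquivalence
  ; reflexive     = from ∘ γ.reflexive
  ; trans         = λ p q → from (γ.trans (to p) (to q))
  }
  where module γ = IsPreorder γ-quasiorder

module _ (ac : AxiomOfChoice ℓ) {A : Set ℓ} where

  private
    em : (P : Set ℓ) → Dec P
    em = choice⇒excluded-middle ac

  -- Representatives of equivalence classes

  module Representatives {ε : Rel A ℓ} (ε-isEquivalence : IsEquivalence ε) where

    private
      module ε = IsEquivalence ε-isEquivalence

      chosen : Σ (Func (Quotient ε ε-isEquivalence) (setoid A)) λ f → ∀ a → ε a (f ⟨$⟩ a)
      chosen = ac _ _ ε (λ p q → ε.trans (ε.sym p) q) (λ { refl q → q }) (λ a → a , ε.refl)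

    rep : A → A
    rep = proj₁ chosen ⟨$⟩_

    rep-cong : ∀ {a b} → ε a b → rep a ≡ rep b
    rep-cong = Func.cong (proj₁ chosen)

    ε-rep : ∀ a → ε a (rep a)
    ε-rep = proj₂ chosen

    rep-reflects : ∀ {a b} → rep a ≡ rep b → ε a b
    rep-reflects {a} {b} p = ε.trans (ε-rep a) (subst (λ x → ε x b) (sym p) (ε.sym (ε-rep b)))

    IsRep : Pred A ℓ
    IsRep x = rep x ≡ x

    rep-isRep : ∀ a → IsRep (rep a)
    rep-isRep a = rep-cong (ε.sym (ε-rep a))

    isRep-isTransversal : IsTransversal ε IsRep
    isRep-isTransversal a =
      rep a , (rep-isRep a , ε-rep a) , λ (y-isRep , a~y) → trans (rep-cong a~y) y-isRep

    -- A model of the quotient whose equality is propositional, as the set `X` of a kernel form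
    -- requires.
    Reps : Set ℓ
    Reps = Σ A IsRep

    toRep : A → Reps
    toRep a = rep a , rep-isRep a

    -- Membership is itself an equation in `A`. Excluded middle decides equality there, so by
    -- Hedberg's theorem such proofs are unique.
    Reps-≡ : {x y : Reps} → proj₁ x ≡ proj₁ y → x ≡ y
    Reps-≡ {x , p} {.x , q} refl = cong (x ,_) (Decidable⇒UIP.≡-irrelevant (λ u v → em (u ≡ v)) p q)

    Reps-ε⇒≡ : {x y : Reps} → ε (proj₁ x) (proj₁ y) → x ≡ y
    Reps-ε⇒≡ {x , p} {y , q} x~y = Reps-≡ (trans (sym p) (trans (rep-cong x~y) q))

  -- From half-spaces to quotients

  halfSpace⇒quotientForm : {α : Rel A ℓ} → IsHalfSpace α → QuotientForm α
  halfSpace⇒quotientForm {α} (α-quasiorder , β , β-quasiorder , (_ , covers) , (meets , _)) =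
    ε , ε-isEquivalence , R , R-linear ,
    record { to = t ; cong = t-cong } , t-singleton , to , from
    where
    module α = IsPreorder α-quasiorder
    module β = IsPreorder β-quasiorder

    cover : ∀ a b → α a b ⊎ β a b
    cover a b = covers (tt , tt)

    -- An order on the quotient must contain `ε`, but on a class where `β` is full `α` is only the
    -- diagonal. Hence `ε` is added to `α` in `R`.
    ε R : Rel A ℓ
    ε a b = (α a b × α b a) ⊎ (β a b × β b a)
    R a b = ε a b ⊎ α a b

    -- Compare `a` with `c`. If `α a c`, then `α b c` through `a`, so `b` and `c` are related by
    -- both quasiorders; if `β a c`, then `β a b` through `c`, and likewise for `a` and `b`. So no
    -- class mixes nontrivial pairs of the two kinds.
    αβ⇒≡ : ∀ {a b c} → α a b × α b a → β b c × β c b → a ≡ b ⊎ b ≡ c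
    αβ⇒≡ {a} {b} {c} (ab , ba) (bc , cb) with cover a c
    ... | inj₁ ac = inj₂ (meets (α.trans ba ac , bc))
    ... | inj₂ ac = inj₁ (meets (ab , β.trans ac cb))

    ε-sym : ∀ {a b} → ε a b → ε b a
    ε-sym (inj₁ (p , q)) = inj₁ (q , p)
    ε-sym (inj₂ (p , q)) = inj₂ (q , p)

    ε-trans : Transitive ε
    ε-trans (inj₁ (p , q)) (inj₁ (r , s)) = inj₁ (α.trans p r , α.trans s q)
    ε-trans (inj₂ (p , q)) (inj₂ (r , s)) = inj₂ (β.trans p r , β.trans s q)
    ε-trans (inj₁ p) (inj₂ q) with αβ⇒≡ p q
    ... | inj₁ refl = inj₂ q
    ... | inj₂ refl = inj₁ p
    ε-trans (inj₂ (p , p′)) (inj₁ (q , q′)) with αβ⇒≡ (q′ , q) (p′ , p)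
    ... | inj₁ refl = inj₂ (p , p′)
    ... | inj₂ refl = inj₁ (q , q′)

    ε-isEquivalence : IsEquivalence ε
    ε-isEquivalence = record { refl = inj₁ (α.refl , α.refl) ; sym = ε-sym ; trans = ε-trans }

    R-trans : Transitive R
    R-trans (inj₁ p) (inj₁ q) = inj₁ (ε-trans p q)
    R-trans (inj₂ p) (inj₂ q) = inj₂ (α.trans p q)
    R-trans (inj₁ (inj₁ (p , _))) (inj₂ q) = inj₂ (α.trans p q)
    R-trans {a} {b} {c} (inj₁ (inj₂ (p , p′))) (inj₂ q) with cover a c
    ... | inj₁ ac = inj₂ ac
    -- Here `β b c` follows through `a`, so the `α`-step from `b` to `c` is trivial; the last case
    -- is the mirror image.
    ... | inj₂ ac with refl ← meets (q , β.trans p′ ac) = inj₁ (inj₂ (p , p′))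
    R-trans (inj₂ p) (inj₁ (inj₁ (q , _))) = inj₂ (α.trans p q)
    R-trans {a} {b} {c} (inj₂ p) (inj₁ (inj₂ (q , q′))) with cover a c
    ... | inj₁ ac = inj₂ ac
    ... | inj₂ ac with refl ← meets (p , β.trans ac q′) = inj₁ (inj₂ (q , q′))

    R-antisym : ∀ {a b} → R a b → R b a → ε a b
    R-antisym (inj₁ p) _        = p
    R-antisym (inj₂ _) (inj₁ q) = ε-sym q
    R-antisym (inj₂ p) (inj₂ q) = inj₁ (p , q)

    R-total : ∀ a b → R a b ⊎ R b a
    R-total a b with cover a b | cover b a
    ... | inj₁ p | _      = inj₁ (inj₂ p)
    ... | inj₂ _ | inj₁ q = inj₂ (inj₂ q)
    ... | inj₂ p | inj₂ q = inj₁ (inj₁ (inj₂ (p , q)))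

    R-linear : IsLinearOrderOn (Quotient ε ε-isEquivalence) R
    R-linear = record
      { isPartialOrder = record
        { isPreorder = record
          { isEquivalence = ε-isEquivalence
          ; reflexive     = inj₁
          ; trans         = R-trans
          }
        ; antisym = R-antisym
        }
      ; total = R-total
      }

    -- This singles out the `α`-full classes with at least two elements. Demanding a distinct twin
    -- gives singletons the value 0.
    HasTwin : Pred A ℓ
    HasTwin a = ∃ λ b → a ≢ b × α a b × α b a

    t : A → Fin 2
    t a = indicator (em (HasTwin a))

    -- By `αβ⇒≡`, a twin of `a` rules out a nontrivial `β`-pair at `a`.
    twin-α : ∀ {a b} → ε a b → HasTwin a → α a b × α b a
    twin-α (inj₁ p) _ = p
    twin-α (inj₂ p) (c , a≢c , ac , ca) with αβ⇒≡ (ca , ac) p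
    ... | inj₁ refl = ⊥-elim (a≢c refl)
    ... | inj₂ refl = α.refl , α.refl

    twin-resp : ∀ {a b} → ε a b → HasTwin a → HasTwin b
    twin-resp {a} {b} p h with em (a ≡ b) | twin-α p h
    ... | yes refl | _       = h
    -- The element `a` is itself a twin of `b`.
    ... | no a≢b   | ab , ba = a , a≢b ∘ sym , ba , ab

    t-cong : ∀ {a b} → ε a b → t a ≡ t b
    t-cong p = indicator-cong (em _) (em _) (twin-resp p) (twin-resp (ε-sym p))

    t-singleton : ∀ a → [ a ] ε ≐ ｛ a ｝ → t a ≡ 0F
    t-singleton a (single , _) = fails⇒indicator≡0 (em _)
      λ (b , a≢b , p) → a≢b (single (inj₁ p))

    Form : Rel A ℓ
    Form = _≡_ ∪ (λ a b → ε a b × t a ≡ 1F) ∪ StrictPart (Quotient ε ε-isEquivalence) R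

    to : ∀ {a b} → α a b → Form a b
    to {a} {b} ab with em (a ≡ b) | em (ε a b)
    ... | yes a≡b | _ = inj₁ a≡b
    ... | no _ | no ¬ε = inj₂ (inj₂ (inj₂ ab , ¬ε))
    ... | no a≢b | yes (inj₁ p) = inj₂ (inj₁ (inj₁ p , holds⇒indicator≡1 (em _) (b , a≢b , p)))
    ... | no a≢b | yes (inj₂ (p , _)) = ⊥-elim (a≢b (meets (ab , p)))

    from : ∀ {a b} → Form a b → α a b
    from (inj₁ refl) = α.refl
    from (inj₂ (inj₁ (p , t≡1))) = proj₁ (twin-α p (indicator≡1⇒holds (em _) t≡1))
    from (inj₂ (inj₂ (inj₁ p , ¬ε))) = ⊥-elim (¬ε p)
    from (inj₂ (inj₂ (inj₂ p , _))) = p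

  -- From quotients to kernel forms

  quotientForm⇒kernelForm : {α : Rel A ℓ} → QuotientForm α → KernelForm α
  quotientForm⇒kernelForm {α} (ε , ε-isEquivalence , R , R-linear , t , _ , to , from) =
    Reps , X₁ , (R on proj₁) , Reps-linear , toRep , to′ ∘ to , from ∘ from′
    where
    open Representatives ε-isEquivalence
    module ε = IsEquivalence ε-isEquivalence
    module R = IsTotalOrder R-linear

    X₁ : Pred Reps ℓ
    X₁ (x , _) = Lift ℓ (t ⟨$⟩ x ≡ 1F)

    Reps-linear : IsLinearOrderOn (setoid Reps) (R on proj₁)
    Reps-linear = record
      { isPartialOrder = record
        { isPreorder = record
          { isEquivalence = isEquivalence
          ; reflexive     = λ { refl → R.refl }
          ; trans         = R.trans
          }
        -- Antisymmetry up to `ε` becomes antisymmetry up to equality, as equivalent representatives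
        -- coincide.
        ; antisym = λ p q → Reps-ε⇒≡ (R.antisym p q)
        }
      ; total = λ x y → R.total (proj₁ x) (proj₁ y)
      }

    t-rep : ∀ a → t ⟨$⟩ rep a ≡ t ⟨$⟩ a
    t-rep a = sym (Func.cong t (ε-rep a))

    to′ : ∀ {a b} → (_≡_ ∪ (λ a b → ε a b × t ⟨$⟩ a ≡ 1F) ∪ StrictPart (Quotient ε ε-isEquivalence) R) a b →
      (ker X₁ toRep ∪ preimage toRep (R on proj₁)) a b
    to′ (inj₁ p) = inj₁ (inj₁ p)
    to′ {a} (inj₂ (inj₁ (p , t≡1))) = inj₁ (inj₂ (Reps-≡ (rep-cong p) , lift (trans (t-rep a) t≡1)))
    to′ {a} {b} (inj₂ (inj₂ (p , ¬ε))) = inj₂ (inj₂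
      ( R.trans (R.reflexive (ε.sym (ε-rep a))) (R.trans p (R.reflexive (ε-rep b)))
      , ¬ε ∘ rep-reflects ∘ cong proj₁ ))

    from′ : ∀ {a b} → (ker X₁ toRep ∪ preimage toRep (R on proj₁)) a b →
      (_≡_ ∪ (λ a b → ε a b × t ⟨$⟩ a ≡ 1F) ∪ StrictPart (Quotient ε ε-isEquivalence) R) a b
    from′ (inj₁ (inj₁ p)) = inj₁ p
    from′ (inj₂ (inj₁ p)) = inj₁ p
    from′ {a} (inj₁ (inj₂ (p , lift t≡1))) =
      inj₂ (inj₁ (rep-reflects (cong proj₁ p) , trans (sym (t-rep a)) t≡1))
    from′ {a} {b} (inj₂ (inj₂ (p , ≢))) = inj₂ (inj₂
      ( R.trans (R.reflexive (ε-rep a)) (R.trans p (R.reflexive (ε.sym (ε-rep b))))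
      , ≢ ∘ Reps-≡ ∘ rep-cong ))

  -- From kernel forms to half-spaces

  kernelForm⇒halfSpace : {α : Rel A ℓ} → KernelForm α → IsHalfSpace α
  kernelForm⇒halfSpace {α} (X , X₁ , R , R-linear , f , to , from) =
    α-quasiorder , β , kernelForm-isQuasiorder (∁ X₁) (Flip.isTotalOrder R-linear) f ,
    ((λ _ → tt , tt) , λ {a} {b} _ → covers a b) ,
    ((λ (p , q) → meets (to p) q) , λ { refl → α.refl , inj₁ (inj₁ refl) })
    where
    module R = IsTotalOrder R-linear

    α-quasiorder : IsQuasiorder α
    α-quasiorder = ⇔-isQuasiorder to from (kernelForm-isQuasiorder X₁ R-linear f)

    module α = IsPreorder α-quasiorder

    β : Rel A ℓ
    β = ker (∁ X₁) f ∪ preimage f (flip R)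

    covers : ∀ a b → α a b ⊎ β a b
    -- Membership in `X₁` assigns pairs with equal values to `α` or `β`; the direction of `R`
    -- assigns the others.
    covers a b with em (f a ≡ f b) | em (f a ∈ X₁) | R.total (f a) (f b)
    ... | yes p | yes x | _      = inj₁ (from (inj₁ (inj₂ (p , x))))
    ... | yes p | no ¬x | _      = inj₂ (inj₁ (inj₂ (p , ¬x)))
    ... | no ≢  | _     | inj₁ p = inj₁ (from (inj₂ (inj₂ (p , ≢))))
    ... | no ≢  | _     | inj₂ p = inj₂ (inj₂ (inj₂ (p , ≢)))

    meets : ∀ {a b} → (ker X₁ f ∪ preimage f R) a b → β a b → a ≡ b
    meets (inj₁ (inj₁ p)) _ = p
    meets (inj₂ (inj₁ p)) _ = p
    meets _ (inj₁ (inj₁ p)) = p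
    meets _ (inj₂ (inj₁ p)) = p
    meets (inj₁ (inj₂ (_ , x))) (inj₁ (inj₂ (_ , ¬x))) = ⊥-elim (¬x x)
    meets (inj₁ (inj₂ (p , _))) (inj₂ (inj₂ (_ , ≢)))  = ⊥-elim (≢ p)
    meets (inj₂ (inj₂ (_ , ≢))) (inj₁ (inj₂ (p , _)))  = ⊥-elim (≢ p)
    meets (inj₂ (inj₂ (p , ≢))) (inj₂ (inj₂ (q , _)))  = ⊥-elim (≢ (R.antisym p q))

  -- From kernel forms to transversals

  kernelForm⇒transversalForm : {α : Rel A ℓ} → KernelForm α → TransversalForm α
  kernelForm⇒transversalForm {α} (X , X₁ , R , R-linear , f , to , from) =
    ε , On.isEquivalence f isEquivalence , classes , linear , saturated
    where
    module R = IsTotalOrder R-linear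
    module α = IsPreorder (⇔-isQuasiorder to from (kernelForm-isQuasiorder X₁ R-linear f))

    ε : Rel A ℓ
    ε a b = f a ≡ f b

    -- Each piece of the kernel form respects the weak order of values. Antisymmetry of `R` thus
    -- turns a two-way `α`-pair into an equality of values.
    α⇒R : ∀ {a b} → α a b → R (f a) (f b)
    α⇒R p with to p
    ... | inj₁ (inj₁ refl)    = R.refl
    ... | inj₂ (inj₁ refl)    = R.refl
    ... | inj₁ (inj₂ (q , _)) = R.reflexive q
    ... | inj₂ (inj₂ (q , _)) = q

    classes : ∀ c → let C = [ c ] ε in (α ∩ C ² ⇔ᵣ C ²) ⊎ (α ∩ C ² ⇔ᵣ _≡_ ∩ C ²)
    classes c with em (f c ∈ X₁)
    ... | yes x = inj₁ (proj₂ , λ (p , q) →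
      from (inj₁ (inj₂ (trans (sym p) q , subst X₁ p x))) , p , q)
    ... | no ¬x = inj₂ ((λ (ab , p , q) → discrete p q (to ab) , p , q) ,
                        (λ { (refl , p) → α.refl , p }))
      where
      discrete : ∀ {a b} → ε c a → ε c b → (ker X₁ f ∪ preimage f R) a b → a ≡ b
      discrete _ _ (inj₁ (inj₁ r)) = r
      discrete _ _ (inj₂ (inj₁ r)) = r
      discrete p _ (inj₁ (inj₂ (_ , x))) = ⊥-elim (¬x (subst X₁ (sym p) x))
      discrete p q (inj₂ (inj₂ (_ , ≢))) = ⊥-elim (≢ (trans (sym p) q))

    linear : ∀ T → IsTransversal ε T → IsLinearOrderOn (Subset T) (α on proj₁)
    linear T transversal = record
      { isPartialOrder = record
        { isPreorder = record
          { isEquivalence = Setoid.isEquivalence (Subset T)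
          ; reflexive     = α.reflexive
          ; trans         = α.trans
          }
        ; antisym = λ {x} {y} p q → unique x y (R.antisym (α⇒R p) (α⇒R q))
        }
      ; total = total
      }
      where
      -- Both points lie in `T` and in the class of `x`, where `T` has only one point; so `f` is
      -- injective on `T`.
      unique : (x y : Σ A T) → ε (proj₁ x) (proj₁ y) → proj₁ x ≡ proj₁ y
      unique (x , x∈T) (y , y∈T) p =
        let _ , _ , ! = transversal x in trans (sym (! (x∈T , refl))) (! (y∈T , p))

      total : (x y : Σ A T) → α (proj₁ x) (proj₁ y) ⊎ α (proj₁ y) (proj₁ x)
      total x y with em (ε (proj₁ x) (proj₁ y)) | R.total (f (proj₁ x)) (f (proj₁ y))
      ... | yes p | _      = inj₁ (α.reflexive (unique x y p))
      ... | no ≢  | inj₁ q = inj₁ (from (inj₂ (inj₂ (q , ≢))))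
      ... | no ≢  | inj₂ q = inj₂ (from (inj₂ (inj₂ (q , ≢ ∘ sym))))

    saturated : ∀ a b → ¬ ε a b → α a b ⇔ (∀ a′ b′ → ε a a′ → ε b b′ → α a′ b′)
    saturated a b ≢ = mk⇔
      -- Moving the ends inside their classes keeps the values of `f`, and these differ, so the new
      -- pair is strictly ordered.
      (λ ab a′ b′ p q → from (inj₂ (inj₂
        ( R.trans (R.reflexive (sym p)) (R.trans (α⇒R ab) (R.reflexive q))
        , λ r → ≢ (trans p (trans r (sym q)))))))
      (λ h → h a b refl refl)

  -- From transversals to kernel forms

  transversalForm⇒kernelForm : {α : Rel A ℓ} → TransversalForm α → KernelForm α
  transversalForm⇒kernelForm {α} (ε , ε-isEquivalence , classes , linear , saturated) =
    Reps , X₁ , (α on proj₁) , Reps-linear , toRep , to , from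
    where
    open Representatives ε-isEquivalence
    module ε = IsEquivalence ε-isEquivalence
    module T = IsTotalOrder (linear IsRep isRep-isTransversal)

    -- The alternatives of `classes` overlap on singletons, so membership in `X₁` is read off from
    -- `α` itself.
    Full : Pred A ℓ
    Full c = ∀ a b → ε c a → ε c b → α a b

    X₁ : Pred Reps ℓ
    X₁ = Full ∘ proj₁

    Reps-linear : IsLinearOrderOn (setoid Reps) (α on proj₁)
    Reps-linear = record
      { isPartialOrder = record
        { isPreorder = record
          { isEquivalence = isEquivalence
          ; reflexive     = λ {x} {y} p → T.reflexive {x} {y} (cong proj₁ p)
          ; trans         = λ {x} {y} {z} → T.trans {x} {y} {z}
          }
        ; antisym = λ {x} {y} p q → Reps-≡ (T.antisym {x} {y} p q)
        }
      ; total = T.total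
      }

    -- Reflexivity is not assumed of `α`, but a full class and a discrete class both contain the
    -- diagonal.
    α-refl : ∀ a → α a a
    α-refl a with classes a
    ... | inj₁ (_ , full)     = proj₁ (full (ε.refl , ε.refl))
    ... | inj₂ (_ , discrete) = proj₁ (discrete (refl , ε.refl , ε.refl))

    -- This carries pairs to representatives in `to` and back to the original elements in `from`.
    transport : ∀ {a b a′ b′} → ¬ ε a b → ε a a′ → ε b b′ → α a b → α a′ b′
    transport ¬ε p q ab = Equivalence.to (saturated _ _ ¬ε) ab _ _ p q

    to : ∀ {a b} → α a b → (ker X₁ toRep ∪ preimage toRep (α on proj₁)) a b
    to {a} {b} ab with em (ε a b)
    ... | no ¬ε = inj₂ (inj₂
      (transport ¬ε (ε-rep a) (ε-rep b) ab , ¬ε ∘ rep-reflects ∘ cong proj₁))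
    ... | yes a~b with classes a
    ...   | inj₂ (discrete , _) = inj₁ (inj₁ (proj₁ (discrete (ab , ε.refl , a~b))))
    ...   | inj₁ (_ , full) = inj₁ (inj₂ (Reps-≡ (rep-cong a~b) ,
      λ x y p q → proj₁ (full (ε.trans (ε-rep a) p , ε.trans (ε-rep a) q))))

    from : ∀ {a b} → (ker X₁ toRep ∪ preimage toRep (α on proj₁)) a b → α a b
    from (inj₁ (inj₁ refl)) = α-refl _
    from (inj₂ (inj₁ refl)) = α-refl _
    from {a} {b} (inj₁ (inj₂ (p , full))) =
      full a b (ε.sym (ε-rep a)) (ε.trans (ε.sym (ε-rep a)) (rep-reflects (cong proj₁ p)))
    from {a} {b} (inj₂ (inj₂ (p , ≢))) =
      transport (≢ ∘ Reps-ε⇒≡) (ε.sym (ε-rep a)) (ε.sym (ε-rep b)) p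

theorem2p11 : ∀ {ℓ : Level} → AxiomOfChoice ℓ → (A : Set ℓ) (α : Rel A ℓ) →
    (IsHalfSpace α ⇔ QuotientForm α) ×
    (QuotientForm α ⇔ KernelForm α) ×
    (KernelForm α ⇔ TransversalForm α)
theorem2p11 ac A α =
  -- The first three conditions form a cycle of implications, so the missing converses are
  -- composites.
  mk⇔ 1⇒2 (3⇒1 ∘ 2⇒3) ,
  mk⇔ 2⇒3 (1⇒2 ∘ 3⇒1) ,
  mk⇔ (kernelForm⇒transversalForm ac) (transversalForm⇒kernelForm ac)
  where
  1⇒2 : IsHalfSpace α → QuotientForm α
  1⇒2 = halfSpace⇒quotientForm ac

  2⇒3 : QuotientForm α → KernelForm α
  2⇒3 = quotientForm⇒kernelForm ac

  3⇒1 : KernelForm α → IsHalfSpace α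
  3⇒1 = kernelForm⇒halfSpace ac
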